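{- Let $G$ and $H$ be graphs without isolated vertices. If $K_2\times G$ and $K_2\times H$ are isomorphic as graphs, then the neighborhood complexes $N(G)$ and $N(H)$ are isomorphic as simplicial complexes. If moreover $G$ and $H$ are locally finite and stiff, then conversely $N(G)\cong N(H)$ implies $K_2\times G\cong K_2\times H$.
   Context: A graph $G$ is a set $V(G)$ together with a symmetric subset $E(G) \subset V(G)\times V(G)$ (undirected, no multiple edges, loops allowed; graphs may be infinite). For $v \in V(G)$, $N(v)=\{w : (v,w)\in E(G)\}$; $v$ is isolated if $N(v)=\emptyset$. $G$ is locally finite if every $N(v)$ is finite. $G$ is stiff if for vertices $v,w$, $N(v)\subset N(w)$ implies $v=w$. $K_2$ is the graph with $V(K_2)=\{1,2\}$ and edges $(1,2),(2,1)$. The tensor product $G\times H$ has vertex set $V(G)\times V(H)$, with $((x,y),(x',y'))$ an edge iff $(x,x')\in E(G)$ and $(y,y')\in E(H)$. The neighborhood complex $N(G)$ is the abstract simplicial complex whose vertices are the non-isolated vertices of $G$ and whose simplices are the finite subsets contained in $N(v)$ for some vertex $v$. -}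

module Defs where

open import Level using (Level; _⊔_; 0ℓ) renaming (suc to lsuc)
open import Data.Fin.Base using (Fin; zero; suc)
open import Data.List.Base using (List; []; _∷_; [_]; map)
open import Data.List.Membership.Propositional using () renaming (_∈_ to _∈ₗ_)
open import Data.List.Relation.Unary.All using (All; []; _∷_)
import Data.List.Relation.Binary.Subset.Setoid as Subset
import Data.List.Relation.Binary.Subset.Setoid.Properties as Subsetₚ
open import Data.Product.Base using (Σ; ∃; _×_; _,_; proj₁)
open import Function.Bundles using (_↔_; _⇔_; Inverse)
open import Function.Base using (_∘_)
open import Relation.Binary.Bundles using (Setoid)
open import Relation.Binary.Core using (Rel)
open import Relation.Binary.Definitions using (Symmetric)
import Relation.Binary.Construct.On as On
open import Relation.Binary.PropositionalEquality using (_≡_; subst; setoid)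
open import Relation.Nullary.Negation.Core using (¬_)
open import Relation.Unary using (Pred; _⊆_; _∈_; Empty; Satisfiable)

record Graph (v e : Level) : Set (lsuc (v ⊔ e)) where
  field
    V    : Set v
    E    : Rel V e
    symE : Symmetric E

  N : V → Pred V e
  N v w = E v w

  Isolated : V → Set (v ⊔ e)
  Isolated v = Empty (N v)

open Graph public using (V; E)

WithoutIsolated : ∀ {v e} → Graph v e → Set (v ⊔ e)
WithoutIsolated G = ∀ v → ¬ Graph.Isolated G v

-- The list may contain repetitions.
Finite : ∀ {a p} {A : Set a} → Pred A p → Set (a ⊔ p)
Finite {A = A} P = ∃ λ (xs : List A) → ∀ x → x ∈ P ⇔ x ∈ₗ xs

LocallyFinite : ∀ {v e} → Graph v e → Set (v ⊔ e)
LocallyFinite G = ∀ v → Finite (Graph.N G v)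

Stiff : ∀ {v e} → Graph v e → Set (v ⊔ e)
Stiff G = ∀ v w → Graph.N G v ⊆ Graph.N G w → v ≡ w

record _≅ᴳ_ {v e v′ e′} (G : Graph v e) (H : Graph v′ e′)
       : Set (v ⊔ e ⊔ v′ ⊔ e′) where
  field
    vertices : V G ↔ V H
    edges    : ∀ x y → E G x y ⇔ E H (Inverse.to vertices x) (Inverse.to vertices y)

data K₂-Edge : Rel (Fin 2) 0ℓ where
  e₁₂ : K₂-Edge zero (suc zero)
  e₂₁ : K₂-Edge (suc zero) zero

K₂ : Graph 0ℓ 0ℓ
K₂ = record
  { V    = Fin 2
  ; E    = K₂-Edge
  ; symE = λ { e₁₂ → e₂₁ ; e₂₁ → e₁₂ }
  }

_×ᴳ_ : ∀ {v e v′ e′} → Graph v e → Graph v′ e′ → Graph (v ⊔ v′) (e ⊔ e′)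
G ×ᴳ H = record
  { V    = V G × V H
  ; E    = λ (x , y) (x′ , y′) → E G x x′ × E H y y′
  ; symE = λ (p , q) → Graph.symE G p , Graph.symE H q
  }

-- A finite set of vertices is represented by a list, with repetitions and
-- order irrelevant: by `downward`, being a simplex depends only on the set of
-- elements of the list.
record SimplicialComplex (c ℓ s : Level) : Set (lsuc (c ⊔ ℓ ⊔ s)) where
  field
    vertices : Setoid c ℓ

  open Setoid vertices using (Carrier)
  open Subset vertices using () renaming (_⊆_ to _⊆ₗ_)

  field
    Simplex   : Pred (List Carrier) s
    singleton : ∀ x → Simplex [ x ]
    downward  : ∀ {xs ys} → xs ⊆ₗ ys → Simplex ys → Simplex xs

record _≅ˢ_ {c ℓ s c′ ℓ′ s′}
            (K : SimplicialComplex c ℓ s) (L : SimplicialComplex c′ ℓ′ s′)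
       : Set (c ⊔ ℓ ⊔ s ⊔ c′ ⊔ ℓ′ ⊔ s′) where
  private
    module K = SimplicialComplex K
    module L = SimplicialComplex L
  field
    vertices  : Inverse K.vertices L.vertices
    simplices : ∀ xs → K.Simplex xs ⇔ L.Simplex (map (Inverse.to vertices) xs)

infix 4 _≅ᴳ_ _≅ˢ_
infixr 7 _×ᴳ_

module _ {v e} (G : Graph v e) where
  open Graph G using (N; symE)

  -- Non-isolated is expressed positively, by the existence of a neighbour; this
  -- is what makes every vertex a simplex without appeal to classical logic.
  -- Vertices are compared in G, ignoring which neighbour is exhibited.
  nonIsolated : Setoid (v ⊔ e) v
  nonIsolated = On.setoid {B = Σ (V G) (Satisfiable ∘ N)} (setoid (V G)) proj₁

  neighborhoodComplex : SimplicialComplex (v ⊔ e) v (v ⊔ e)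
  neighborhoodComplex = record
    { vertices  = nonIsolated
    ; Simplex   = λ xs → ∃ λ u → All ((_∈ N u) ∘ proj₁) xs
    ; singleton = λ (_ , w , vw) → w , symE vw ∷ []
    ; downward  = λ xs⊆ys (u , ys⊆Nu) → u ,
        Subsetₚ.All-resp-⊇ nonIsolated (subst (_∈ N u)) (λ {x} → xs⊆ys {x}) ys⊆Nu
    }

{-# OPTIONS --safe #-}
module Submission where

-- K₂ × G carries two fixed-point-free involutions: swapping the two copies of G and, through the
-- isomorphism, swapping the two copies of H. Joining every point to its two images splits K₂ × G
-- into chains (infinite lines or cycles) whose edges are alternately vertices of G and vertices of H,
-- and every edge is oriented from copy 0 to copy 1. A bijection V(G) → V(H) is obtained as in the
-- choice-free proof that 2a = 2b implies a = b: each vertex of G is paired with a vertex of H at odd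
-- distance on its chain, by a rule invariant under translation and reversal of the chain. Let the
-- height along a chain be the number of edges followed minus the number of edges traversed
-- backwards. If one end of the chain eventually stays above some level that the other end eventually
-- stays below or on, the chain has a canonical direction, in which each vertex of G is paired with
-- the next edge. Otherwise, consider the edges crossing a given level; they alternate in orientation
-- and also between G and H. If no end stays above the level, pair each with the next crossing in its
-- own direction, else with the next crossing behind it.
-- The rule depends only on the orientations met along the chain. These are the same for all members
-- of a simplex, since adjacent points of K₂ × G carry opposite orientations at every step; hence all
-- members of a simplex are moved by the same word in the two involutions, which preserve adjacency.
--
-- Conversely, for G locally finite and stiff the sets N(v) are the maximal simplices and determine v,
-- so an isomorphism φ of complexes induces θ with N(θ v) = φ(N(v)), and (φ , θ) acts on K₂ × G.

open import Defs
open import Level using (_⊔_; 0ℓ; Lift; lift; lower)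
open import Axiom.ExcludedMiddle using (ExcludedMiddle)
open import Data.Bool.Base using (Bool; true; false; not; _xor_)
open import Data.Bool.Properties using (not-involutive; not-distribʳ-xor; not-distribˡ-xor; xor-identityʳ)
open import Data.Fin.Base using (Fin; zero; suc)
open import Data.Integer.Base as ℤ using (ℤ; +[1+_]; -[1+_]; 0ℤ; _◃_; _+_; -_) renaming (+_ to pos)
import Data.Integer.Properties as ℤₚ
open import Data.List.Base using (List; []; _∷_; _++_; map; replicate)
open import Data.List.Relation.Unary.All as All using (All; []; _∷_)
import Data.List.Relation.Unary.All.Properties as Allₚ
open import Data.List.Relation.Unary.Any as Any using (here)
import Data.List.Relation.Unary.Any.Properties as Anyₚ
open import Data.Nat.Base as ℕ using (ℕ; zero; suc; _≤_; _<_; s≤s; z<s) renaming (_+_ to _+ℕ_)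
open import Data.Nat.Induction using (<-rec)
import Data.Nat.Properties as ℕₚ
open import Data.Product.Base using (∃; _×_; _,_; proj₁; proj₂)
open import Data.Sign.Base using (Sign; opposite)
open import Data.Sign.Properties using (opposite-involutive)
open import Data.Sum.Base as Sum using (_⊎_; inj₁; inj₂)
open import Function.Base using (_∘_)
open import Function.Bundles using (_⇔_; Inverse; Equivalence; mk⇔; mk↔ₛ′)
import Function.Construct.Symmetry as Symmetry
open import Relation.Binary.Bundles using (Setoid)
open import Relation.Binary.Core using (Rel)
open import Relation.Binary.Definitions using (tri<; tri≈; tri>)
open import Relation.Binary.PropositionalEquality
open import Relation.Nullary using (¬_; Dec; yes; no; contradiction)
open import Relation.Nullary.Decidable using (map′; decidable-stable)
open import Relation.Unary using (Pred; Decidable; Satisfiable; _∈_)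

-- Signs, parity of integers, least witnesses.

pattern up   = Sign.+
pattern down = Sign.-

δ : Sign → ℤ
δ c = c ◃ 1

δ-opposite : ∀ c → δ (opposite c) ≡ - δ c
δ-opposite up   = refl
δ-opposite down = refl

cancel-neg : ∀ i j → - i + (i + j) ≡ j
cancel-neg i j = trans (sym (ℤₚ.+-assoc (- i) i j))
  (trans (cong (_+ j) (ℤₚ.+-inverseˡ i)) (ℤₚ.+-identityˡ j))

+-cancelˡ-< : ∀ i {j k} → i + j ℤ.< i + k → j ℤ.< k
+-cancelˡ-< i p = subst₂ ℤ._<_ (cancel-neg i _) (cancel-neg i _) (ℤₚ.+-monoʳ-< (- i) p)

+-cancelˡ-≤ : ∀ i {j k} → i + j ℤ.≤ i + k → j ℤ.≤ k
+-cancelˡ-≤ i p = subst₂ ℤ._≤_ (cancel-neg i _) (cancel-neg i _) (ℤₚ.+-monoʳ-≤ (- i) p)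

odd : ℤ → Bool
odd (pos zero)   = false
odd +[1+ n ]     = not (odd (pos n))
odd -[1+ zero ]  = true
odd -[1+ suc n ] = not (odd -[1+ n ])

odd-δ+ : ∀ c z → odd (δ c + z) ≡ not (odd z)
odd-δ+ up   (pos n)      = refl
odd-δ+ up   -[1+ zero ]  = refl
odd-δ+ up   -[1+ suc n ] = sym (not-involutive _)
odd-δ+ down (pos zero)   = refl
odd-δ+ down +[1+ n ]     = sym (not-involutive _)
odd-δ+ down -[1+ n ]     = refl

least : ∀ {p} {P : Pred ℕ p} → Decidable P → ∀ n → P n → ∃ λ m → P m × ∀ {k} → k < m → ¬ P k
least {P = P} P? = <-rec _ λ n rec Pn → go n rec Pn (ℕₚ.anyUpTo? P? n)
  where
  Least = ∃ λ m → P m × ∀ {k} → k < m → ¬ P k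
  go : ∀ n → (∀ {m} → m < n → P m → Least) → P n → Dec (∃ λ m → m < n × P m) → Least
  go n rec Pn (yes (m , m<n , Pm)) = rec m<n Pm
  go n rec Pn (no none)            = n , Pn , λ k<n Pk → none (_ , k<n , Pk)

-- Walks and words in the two moves.

data Move : Set where
  advance turn : Move

module Walk {a} {S : Set a} (τ ρ : S → S) where

  walk : S → ℕ → S
  walk x zero    = x
  walk x (suc n) = walk (τ x) n

  act : List Move → S → S
  act []            x = x
  act (advance ∷ w) x = act w (τ x)
  act (turn ∷ w)    x = act w (ρ x)

  walk-+ : ∀ x m n → walk x (m +ℕ n) ≡ walk (walk x m) n
  walk-+ x zero    n = refl
  walk-+ x (suc m) n = walk-+ (τ x) m n

  walk-suc : ∀ x n → walk x (suc n) ≡ τ (walk x n)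
  walk-suc x zero    = refl
  walk-suc x (suc n) = walk-suc (τ x) n

  act-replicate : ∀ n w x → act (replicate n advance ++ w) x ≡ act w (walk x n)
  act-replicate zero    w x = refl
  act-replicate (suc n) w x = act-replicate n w (τ x)

-- An element of S is an edge of a chain together with a direction of travel. τ passes to the next
-- edge; ρ turns round at the starting point, so that ρ ∘ τ reverses an edge. s tells whether the edge
-- is traversed along its orientation, and κ to which of the two sets it belongs.
module Chain
  {a} {S : Set a} (τ ρ : S → S) (s : S → Sign) (κ : S → Bool)
  (ρρ : ∀ x → ρ (ρ x) ≡ x) (τρτ : ∀ x → τ (ρ (τ x)) ≡ ρ x)
  (s-reverse : ∀ x → s (ρ (τ x)) ≡ opposite (s x))
  (κ-τ : ∀ x → κ (τ x) ≡ not (κ x)) (κ-ρ : ∀ x → κ (ρ x) ≡ not (κ x))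
  (em : ExcludedMiddle 0ℓ)
  where

  open Walk τ ρ public

  reverse : S → S
  reverse x = ρ (τ x)

  reverse-involutive : ∀ x → reverse (reverse x) ≡ x
  reverse-involutive x = trans (cong ρ (τρτ x)) (ρρ x)

  -- Heights along a chain.

  height : S → ℕ → ℤ
  height x zero    = 0ℤ
  height x (suc n) = δ (s x) + height (τ x) n

  height-+ : ∀ x m n → height x (m +ℕ n) ≡ height x m + height (walk x m) n
  height-+ x zero    n = sym (ℤₚ.+-identityˡ _)
  height-+ x (suc m) n = trans (cong (δ (s x) +_) (height-+ (τ x) m n))
                               (sym (ℤₚ.+-assoc (δ (s x)) _ _))

  height-suc : ∀ x n → height x (suc n) ≡ height x n + δ (s (walk x n))
  height-suc x n = trans (cong (height x) (ℕₚ.+-comm 1 n))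
    (trans (height-+ x n 1) (cong (height x n +_) (ℤₚ.+-identityʳ _)))

  -- By `τρτ`, each step taken after turning undoes the last one not yet undone, so the walk
  -- retraces itself and ends at the start, facing away from its first edge.
  walk-back : ∀ n x → walk (ρ (walk x n)) n ≡ ρ x
  walk-back zero    x = refl
  walk-back (suc n) x = trans (walk-suc (ρ (walk (τ x) n)) n)
    (trans (cong τ (walk-back n (τ x))) (τρτ x))

  height-back : ∀ n x → height (ρ (walk x n)) n ≡ - height x n
  height-back zero    x = refl
  height-back (suc n) x = begin
    height y (suc n)                                 ≡⟨ height-suc y n ⟩
    height y n + δ (s (walk y n))                    ≡⟨ cong₂ (λ i z → i + δ (s z)) (height-back n (τ x)) (walk-back n (τ x)) ⟩
    - height (τ x) n + δ (s (reverse x))             ≡⟨ cong (λ c → - height (τ x) n + δ c) (s-reverse x) ⟩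
    - height (τ x) n + δ (opposite (s x))            ≡⟨ cong (- height (τ x) n +_) (δ-opposite (s x)) ⟩
    - height (τ x) n + - δ (s x)                     ≡⟨ ℤₚ.+-comm (- height (τ x) n) (- δ (s x)) ⟩
    - δ (s x) + - height (τ x) n                     ≡⟨ ℤₚ.neg-distrib-+ (δ (s x)) (height (τ x) n) ⟨
    - height x (suc n)                               ∎
    where
    open ≡-Reasoning
    y = ρ (walk x (suc n))

  -- Both `κ` and the parity of the height change at every step.
  κ-walk : ∀ n x → κ (walk x n) ≡ κ x xor odd (height x n)
  κ-walk zero    x = sym (xor-identityʳ (κ x))
  κ-walk (suc n) x = begin
    κ (walk (τ x) n)                     ≡⟨ κ-walk n (τ x) ⟩
    κ (τ x) xor odd (height (τ x) n)     ≡⟨ cong (_xor odd (height (τ x) n)) (κ-τ x) ⟩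
    not (κ x) xor odd (height (τ x) n)   ≡⟨ not-distribˡ-xor (κ x) _ ⟨
    not (κ x xor odd (height (τ x) n))   ≡⟨ not-distribʳ-xor (κ x) _ ⟩
    κ x xor not (odd (height (τ x) n))   ≡⟨ cong (κ x xor_) (odd-δ+ (s x) _) ⟨
    κ x xor odd (height x (suc n))       ∎
    where open ≡-Reasoning

  κ-reverse : ∀ x → κ (reverse x) ≡ κ x
  κ-reverse x = trans (κ-ρ (τ x)) (trans (cong not (κ-τ x)) (not-involutive (κ x)))

  κ-return : ∀ n x → height x n ≡ 0ℤ → κ (ρ (walk x n)) ≡ not (κ x)
  κ-return n x h≡0 = trans (κ-ρ _) (cong not (trans (κ-walk n x)
    (trans (cong (λ z → κ x xor odd z) h≡0) (xor-identityʳ (κ x)))))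

  -- First returns to the starting level.

  NoReturn : S → ℕ → Set
  NoReturn x n = ∀ {m} → m < n → height x (suc m) ≢ 0ℤ

  FirstReturn : S → ℕ → Set
  FirstReturn x n = height x (suc n) ≡ 0ℤ × NoReturn x n

  firstReturn-unique : ∀ {x m n} → FirstReturn x m → FirstReturn x n → m ≡ n
  firstReturn-unique {m = m} {n} (m0 , m<) (n0 , n<) with ℕₚ.<-cmp m n
  ... | tri< m<n _ _ = contradiction m0 (n< m<n)
  ... | tri≈ _ m≡n _ = m≡n
  ... | tri> _ _ n<m = contradiction n0 (m< n<m)

  firstReturn : ∀ {x} n → height x (suc n) ≡ 0ℤ → ∃ (FirstReturn x)
  firstReturn {x} = least (λ n → height x (suc n) ℤₚ.≟ 0ℤ)

  -- An earlier return of the reversed excursion would cut the original one at an interior point of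
  -- height 0.
  firstReturn-back : ∀ {x n} → FirstReturn x n → FirstReturn (ρ (walk x (suc n))) n
  firstReturn-back {x} {n} (h≡0 , h≢0) =
    trans (height-back (suc n) x) (cong -_ h≡0) , later
    where
    later : NoReturn (ρ (walk x (suc n))) n
    later {m} m<n h′≡0 with ℕₚ.m≤n⇒∃[o]m+o≡n m<n
    ... | j , refl = h≢0 (s≤s (ℕₚ.m≤n+m j m)) (begin
      height x (suc j)                                     ≡⟨ ℤₚ.+-identityʳ _ ⟨
      height x (suc j) + 0ℤ                                ≡⟨ cong (height x (suc j) +_) tail≡0 ⟨
      height x (suc j) + height (walk x (suc j)) (suc m)   ≡⟨ height-+ x (suc j) (suc m) ⟨
      height x (suc j +ℕ suc m)                            ≡⟨ cong (height x) j+m ⟩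
      height x (suc (suc m +ℕ j))                          ≡⟨ h≡0 ⟩
      0ℤ                                                   ∎)
      where
      open ≡-Reasoning
      j+m : suc j +ℕ suc m ≡ suc (suc m +ℕ j)
      j+m = cong suc (ℕₚ.+-comm j (suc m))
      tail≡0 : height (walk x (suc j)) (suc m) ≡ 0ℤ
      tail≡0 = ℤₚ.neg-injective (begin
        - height (walk x (suc j)) (suc m)                        ≡⟨ height-back (suc m) (walk x (suc j)) ⟨
        height (ρ (walk (walk x (suc j)) (suc m))) (suc m)       ≡⟨ cong (λ y → height (ρ y) (suc m)) (walk-+ x (suc j) (suc m)) ⟨
        height (ρ (walk x (suc j +ℕ suc m))) (suc m)             ≡⟨ cong (λ k → height (ρ (walk x k)) (suc m)) j+m ⟩
        height (ρ (walk x (suc (suc m +ℕ j)))) (suc m)           ≡⟨ h′≡0 ⟩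
        0ℤ                                                       ∎)

  -- Unit steps cannot change the sign of the height without meeting 0.
  height-keeps-sign : ∀ n {x} → NoReturn x (suc n) → ∃ λ k → height x (suc n) ≡ s x ◃ suc k
  height-keeps-sign zero    {x} _    = zero , ℤₚ.+-identityʳ _
  height-keeps-sign (suc n) {x} h≢0 =
    let k , eq = height-keeps-sign n {x} (h≢0 ∘ ℕₚ.m<n⇒m<1+n)
        eq′    = trans (height-suc x (suc n)) (cong (_+ δ (s (walk x (suc n)))) eq)
        k′ , r = step (s x) k (s (walk x (suc n))) (λ p → h≢0 (ℕₚ.n<1+n (suc n)) (trans eq′ p))
    in k′ , trans eq′ r
    where
    step : ∀ c k d → (c ◃ suc k) + δ d ≢ 0ℤ → ∃ λ k′ → (c ◃ suc k) + δ d ≡ c ◃ suc k′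
    step up   k       up   _  = k +ℕ 1 , refl
    step up   zero    down ≢0 = contradiction refl ≢0
    step up   (suc k) down _  = k , refl
    step down k       down _  = suc (k +ℕ 0) , refl
    step down zero    up   ≢0 = contradiction refl ≢0
    step down (suc k) up   _  = k , refl

  -- Before the last step the height still has the sign of the first step, so the last step is
  -- opposite to the first; travelled backwards it agrees with it.
  s-return : ∀ {n x} → FirstReturn x n → s (ρ (walk x (suc n))) ≡ s x
  -- A single step never leads back to height 0.
  s-return {zero}  {x} (h≡0 , _) with s x
  s-return {zero}  {x} (() , _) | up
  s-return {zero}  {x} (() , _) | down
  s-return {suc n} {x} (h≡0 , h≢0) =
    let k , eq = height-keeps-sign n {x} h≢0
        last   = closing (s x) k (s (walk x (suc n)))
                   (trans (cong (_+ δ (s (walk x (suc n)))) (sym eq))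
                          (trans (sym (height-suc x (suc n))) h≡0))
    in begin
      s (ρ (walk x (suc (suc n))))     ≡⟨ cong (s ∘ ρ) (walk-suc x (suc n)) ⟩
      s (reverse (walk x (suc n)))     ≡⟨ s-reverse _ ⟩
      opposite (s (walk x (suc n)))    ≡⟨ cong opposite last ⟩
      opposite (opposite (s x))        ≡⟨ opposite-involutive (s x) ⟩
      s x                              ∎
    where
    open ≡-Reasoning
    closing : ∀ c k d → (c ◃ suc k) + δ d ≡ 0ℤ → d ≡ opposite c
    closing up   _ down _ = refl
    closing down _ up   _ = refl
    closing up   zero    up ()
    closing up   (suc _) up ()
    closing down _ down ()

  -- The ends of a chain relative to a level.

  -- Strict above and weak below are the two sides of the line halfway between `ℓ` and `ℓ + 1`. Only
  -- integers and naturals are compared, so these are propositions of level 0, whatever the level of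
  -- `S`.
  Above Below : ℤ → S → Set
  Above ℓ x = ∃ λ M → ∀ {n} → M ≤ n → ℓ ℤ.< height x n
  Below ℓ x = ∃ λ M → ∀ {n} → M ≤ n → height x n ℤ.≤ ℓ

  δ-reverse : ∀ x → δ (s (reverse x)) ≡ - δ (s x)
  δ-reverse x = trans (cong δ (s-reverse x)) (δ-opposite (s x))

  above-τ⁻ : ∀ {ℓ x} → Above ℓ (τ x) → Above (δ (s x) + ℓ) x
  above-τ⁻ {x = x} (M , q) = suc M , λ { (s≤s M≤n) → ℤₚ.+-monoʳ-< (δ (s x)) (q M≤n) }

  above-τ⁺ : ∀ {ℓ x} → Above (δ (s x) + ℓ) x → Above ℓ (τ x)
  above-τ⁺ {x = x} (M , q) = M , λ M≤n → +-cancelˡ-< (δ (s x)) (q (ℕₚ.m≤n⇒m≤1+n M≤n))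

  below-τ⁻ : ∀ {ℓ x} → Below ℓ (τ x) → Below (δ (s x) + ℓ) x
  below-τ⁻ {x = x} (M , q) = suc M , λ { (s≤s M≤n) → ℤₚ.+-monoʳ-≤ (δ (s x)) (q M≤n) }

  below-τ⁺ : ∀ {ℓ x} → Below (δ (s x) + ℓ) x → Below ℓ (τ x)
  below-τ⁺ {x = x} (M , q) = M , λ M≤n → +-cancelˡ-≤ (δ (s x)) (q (ℕₚ.m≤n⇒m≤1+n M≤n))

  δ-cancel : ∀ x ℓ → δ (s x) + (δ (s (reverse x)) + ℓ) ≡ ℓ
  δ-cancel x ℓ = subst (λ i → i + (δ (s (reverse x)) + ℓ) ≡ ℓ)
    (trans (cong -_ (δ-reverse x)) (ℤₚ.neg-involutive (δ (s x))))
    (cancel-neg (δ (s (reverse x))) ℓ)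

  δ-cancel′ : ∀ x ℓ → δ (s (reverse x)) + (δ (s x) + ℓ) ≡ ℓ
  δ-cancel′ x ℓ = trans (cong (_+ (δ (s x) + ℓ)) (δ-reverse x)) (cancel-neg (δ (s x)) ℓ)

  -- By `τρτ`, the walk from `reverse x` is one step opposite to `s x` followed by the walk from
  -- `ρ x`.
  above-reverse⁻ : ∀ {ℓ x} → Above ℓ (reverse x) → Above (δ (s x) + ℓ) (ρ x)
  above-reverse⁻ {ℓ} {x} p = subst (Above _) (τρτ x)
    (above-τ⁺ (subst (λ i → Above i (reverse x)) (sym (δ-cancel′ x ℓ)) p))

  above-reverse⁺ : ∀ {ℓ x} → Above (δ (s x) + ℓ) (ρ x) → Above ℓ (reverse x)
  above-reverse⁺ {ℓ} {x} p = subst (λ i → Above i (reverse x)) (δ-cancel′ x ℓ)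
    (above-τ⁻ (subst (Above _) (sym (τρτ x)) p))

  below-reverse⁻ : ∀ {ℓ x} → Below ℓ (reverse x) → Below (δ (s x) + ℓ) (ρ x)
  below-reverse⁻ {ℓ} {x} p = subst (Below _) (τρτ x)
    (below-τ⁺ (subst (λ i → Below i (reverse x)) (sym (δ-cancel′ x ℓ)) p))

  below-reverse⁺ : ∀ {ℓ x} → Below (δ (s x) + ℓ) (ρ x) → Below ℓ (reverse x)
  below-reverse⁺ {ℓ} {x} p = subst (λ i → Below i (reverse x)) (δ-cancel′ x ℓ)
    (below-τ⁻ (subst (Below _) (sym (τρτ x)) p))

  -- Allowing either end makes this a property of the chain and the level: turning preserves it, and
  -- walking only shifts `ℓ` by the height.
  EndAbove : ℤ → S → Set
  EndAbove ℓ x = Above ℓ x ⊎ Above ℓ (ρ x)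

  endAbove-ρ : ∀ {ℓ x} → EndAbove ℓ x → EndAbove ℓ (ρ x)
  endAbove-ρ {ℓ} {x} (inj₁ p) = inj₂ (subst (Above ℓ) (sym (ρρ x)) p)
  endAbove-ρ (inj₂ p) = inj₁ p

  endAbove-ρ⁻ : ∀ {ℓ x} → EndAbove ℓ (ρ x) → EndAbove ℓ x
  endAbove-ρ⁻ {ℓ} {x} = subst (EndAbove ℓ) (ρρ x) ∘ endAbove-ρ

  endAbove-walk⁻ : ∀ n {ℓ x} → EndAbove ℓ (walk x n) → EndAbove (height x n + ℓ) x
  endAbove-walk⁻ zero    {ℓ} {x} = subst (λ i → EndAbove i x) (sym (ℤₚ.+-identityˡ ℓ))
  endAbove-walk⁻ (suc n) {ℓ} {x} p = subst (λ i → EndAbove i x)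
    (sym (ℤₚ.+-assoc (δ (s x)) (height (τ x) n) ℓ))
    (Sum.map above-τ⁻ above-reverse⁻ (endAbove-walk⁻ n p))

  endAbove-walk⁺ : ∀ n {ℓ x} → EndAbove (height x n + ℓ) x → EndAbove ℓ (walk x n)
  endAbove-walk⁺ zero    {ℓ} {x} = subst (λ i → EndAbove i x) (ℤₚ.+-identityˡ ℓ)
  endAbove-walk⁺ (suc n) {ℓ} {x} p = endAbove-walk⁺ n
    (Sum.map above-τ⁺ above-reverse⁺
      (subst (λ i → EndAbove i x) (ℤₚ.+-assoc (δ (s x)) (height (τ x) n) ℓ) p))

  endAbove-return⁻ : ∀ {n ℓ x} → FirstReturn x n → EndAbove ℓ (ρ (walk x (suc n))) → EndAbove ℓ x
  endAbove-return⁻ {n} {ℓ} {x} (h≡0 , _) p = subst (λ i → EndAbove i x)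
    (trans (cong (_+ ℓ) h≡0) (ℤₚ.+-identityˡ ℓ)) (endAbove-walk⁻ (suc n) (endAbove-ρ⁻ p))

  endAbove-return⁺ : ∀ {n ℓ x} → FirstReturn x n → EndAbove ℓ x → EndAbove ℓ (ρ (walk x (suc n)))
  endAbove-return⁺ {n} {ℓ} {x} (h≡0 , _) p = endAbove-ρ (endAbove-walk⁺ (suc n)
    (subst (λ i → EndAbove i x) (sym (trans (cong (_+ ℓ) h≡0) (ℤₚ.+-identityˡ ℓ))) p))

  endAbove-reverse⁺ : ∀ {ℓ x} → EndAbove (δ (s x) + ℓ) x → EndAbove ℓ (reverse x)
  endAbove-reverse⁺ {ℓ} {x} = endAbove-ρ ∘ Sum.map above-τ⁺ above-reverse⁺

  -- Directed chains.

  Rising : S → Set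
  Rising x = ∃ λ ℓ → Above ℓ x × Below ℓ (ρ x)

  above<below : ∀ {i j x} → Above i x → Below j x → i ℤ.< j
  above<below (M , p) (M′ , q) = ℤₚ.<-≤-trans (p (ℕₚ.m≤m⊔n M M′)) (q (ℕₚ.m≤n⊔m M M′))

  -- Comparing the two witnessing levels at one end gives `ℓ < ℓ′`, and at the other end `ℓ′ < ℓ`.
  rising-exclusive : ∀ {x} → Rising x → ¬ Rising (ρ x)
  rising-exclusive {x} (ℓ , a , b) (ℓ′ , a′ , b′) =
    ℤₚ.<-asym (above<below a (subst (Below ℓ′) (ρρ x) b′)) (above<below a′ b)

  rising-τ⁺ : ∀ {x} → Rising x → Rising (τ x)
  -- Levels are measured from the starting point, which moves by `δ (s x)`; the summand
  -- `δ (s (reverse x))` is its negative.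
  rising-τ⁺ {x} (ℓ , a , b) = δ (s (reverse x)) + ℓ ,
    above-τ⁺ (subst (λ i → Above i x) (sym (δ-cancel x ℓ)) a) ,
    below-reverse⁺ (subst (λ i → Below i (ρ x)) (sym (δ-cancel x ℓ)) b)

  rising-τ⁻ : ∀ {x} → Rising (τ x) → Rising x
  rising-τ⁻ {x} (ℓ , a , b) = δ (s x) + ℓ , above-τ⁻ a , below-reverse⁻ b

  Directed : S → Set
  Directed x = Rising x ⊎ Rising (ρ x)

  directed-ρ⁻ : ∀ {x} → Directed (ρ x) → Directed x
  directed-ρ⁻ {x} (inj₁ p) = inj₂ p
  directed-ρ⁻ {x} (inj₂ p) = inj₁ (subst Rising (ρρ x) p)

  directed-τ⁻ : ∀ {x} → Directed (τ x) → Directed x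
  directed-τ⁻ {x} (inj₁ p) = inj₁ (rising-τ⁻ p)
  directed-τ⁻ {x} (inj₂ p) = inj₂ (subst Rising (τρτ x) (rising-τ⁺ p))

  directed-walk⁻ : ∀ n {x} → Directed (walk x n) → Directed x
  directed-walk⁻ zero    p = p
  directed-walk⁻ (suc n) p = directed-τ⁻ (directed-walk⁻ n p)

  directed-return⁻ : ∀ n {x} → Directed (ρ (walk x (suc n))) → Directed x
  directed-return⁻ n = directed-walk⁻ (suc n) ∘ directed-ρ⁻

  directed-reverse⁻ : ∀ {x} → Directed (reverse x) → Directed x
  directed-reverse⁻ = directed-τ⁻ ∘ directed-ρ⁻

  -- On a directed chain each edge with κ = true is paired with the next one in the rising direction.
  -- The names say where this puts the partner of x with respect to its direction of travel.
  Ahead Behind : S → Set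
  Ahead x  = κ x ≡ true × Rising x ⊎ κ x ≡ false × Rising (ρ x)
  Behind x = κ x ≡ true × Rising (ρ x) ⊎ κ x ≡ false × Rising x

  ahead⇒directed : ∀ {x} → Ahead x → Directed x
  ahead⇒directed = Sum.map proj₂ proj₂

  behind⇒directed : ∀ {x} → Behind x → Directed x
  behind⇒directed = Sum.swap ∘ Sum.map proj₂ proj₂

  directed⇒ahead⊎behind : ∀ {x} → Directed x → Ahead x ⊎ Behind x
  directed⇒ahead⊎behind {x} d with κ x
  directed⇒ahead⊎behind (inj₁ p) | true  = inj₁ (inj₁ (refl , p))
  directed⇒ahead⊎behind (inj₁ p) | false = inj₂ (inj₂ (refl , p))
  directed⇒ahead⊎behind (inj₂ p) | true  = inj₂ (inj₁ (refl , p))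
  directed⇒ahead⊎behind (inj₂ p) | false = inj₁ (inj₂ (refl , p))

  ahead-behind-exclusive : ∀ {x} → Ahead x → ¬ Behind x
  ahead-behind-exclusive (inj₁ (_ , p)) (inj₁ (_ , q)) = rising-exclusive p q
  ahead-behind-exclusive (inj₁ (k , _)) (inj₂ (l , _)) with () ← trans (sym k) l
  ahead-behind-exclusive (inj₂ (k , _)) (inj₁ (l , _)) with () ← trans (sym k) l
  ahead-behind-exclusive (inj₂ (_ , p)) (inj₂ (_ , q)) = rising-exclusive q p

  private
    flip-κ : ∀ {x y b} → κ y ≡ not (κ x) → κ x ≡ b → κ y ≡ not b
    flip-κ p refl = p

  -- The step keeps the rising direction but changes `κ`, so the rule now points back to the edge
  -- just left.
  ahead-τ : ∀ {x} → Ahead x → Behind (τ x)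
  ahead-τ {x} (inj₁ (k , p)) = inj₂ (flip-κ (κ-τ x) k , rising-τ⁺ p)
  ahead-τ {x} (inj₂ (k , p)) = inj₁ (flip-κ (κ-τ x) k , rising-τ⁻ (subst Rising (sym (τρτ x)) p))

  behind-ρ : ∀ {x} → Behind x → Behind (ρ x)
  behind-ρ {x} (inj₁ (k , p)) = inj₂ (flip-κ (κ-ρ x) k , p)
  behind-ρ {x} (inj₂ (k , p)) = inj₁ (flip-κ (κ-ρ x) k , subst Rising (sym (ρρ x)) p)

  ahead-ρ : ∀ {x} → Ahead x → Ahead (ρ x)
  ahead-ρ {x} (inj₁ (k , p)) = inj₂ (flip-κ (κ-ρ x) k , subst Rising (sym (ρρ x)) p)
  ahead-ρ {x} (inj₂ (k , p)) = inj₁ (flip-κ (κ-ρ x) k , p)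

  behind-τ : ∀ {x} → Behind x → Ahead (τ x)
  behind-τ {x} (inj₁ (k , p)) = inj₂ (flip-κ (κ-τ x) k , rising-τ⁻ (subst Rising (sym (τρτ x)) p))
  behind-τ {x} (inj₂ (k , p)) = inj₁ (flip-κ (κ-τ x) k , rising-τ⁺ p)

  -- Routes from an edge to its partner.

  -- The argument is the sign with which the neighbouring edge is met; a final turn makes the
  -- resulting sign up.
  aheadMoves behindMoves : Sign → List Move
  aheadMoves up    = advance ∷ []
  aheadMoves down  = advance ∷ advance ∷ turn ∷ []
  behindMoves up   = turn ∷ []
  behindMoves down = turn ∷ advance ∷ turn ∷ []

  facingMoves backingMoves : ℕ → List Move
  facingMoves n  = replicate (suc n) advance ++ turn ∷ []
  backingMoves n = advance ∷ turn ∷ replicate (suc n) advance ++ turn ∷ advance ∷ turn ∷ []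

  -- Indexed by the word, because the word, unlike the partner, is common to all members of a
  -- simplex. For `x` of sign `up`, `EndAbove 0ℤ` concerns the line between heights 0 and 1, which
  -- `x` itself crosses.
  data Route (x : S) : List Move → Set where
    ahead   : Ahead x → Route x (aheadMoves (s (τ x)))
    behind  : Behind x → Route x (behindMoves (s (ρ x)))
    facing  : ∀ {n} → ¬ Directed x → ¬ EndAbove 0ℤ x → FirstReturn x n → Route x (facingMoves n)
    backing : ∀ {n} → ¬ Directed x → EndAbove 0ℤ x → FirstReturn (reverse x) n → Route x (backingMoves n)

  -- Makes the word independent of which witnesses `em` returns, so that a route found for one state
  -- can serve for another.
  route-unique : ∀ {x w w′} → Route x w → Route x w′ → w ≡ w′
  route-unique (ahead _)       (ahead _)       = refl
  route-unique (ahead p)       (behind q)      = contradiction q (ahead-behind-exclusive p)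
  route-unique (ahead p)       (facing ¬d _ _) = contradiction (ahead⇒directed p) ¬d
  route-unique (ahead p)       (backing ¬d _ _) = contradiction (ahead⇒directed p) ¬d
  route-unique (behind p)      (ahead q)       = contradiction p (ahead-behind-exclusive q)
  route-unique (behind _)      (behind _)      = refl
  route-unique (behind p)      (facing ¬d _ _) = contradiction (behind⇒directed p) ¬d
  route-unique (behind p)      (backing ¬d _ _) = contradiction (behind⇒directed p) ¬d
  route-unique (facing ¬d _ _) (ahead p)       = contradiction (ahead⇒directed p) ¬d
  route-unique (facing ¬d _ _) (behind p)      = contradiction (behind⇒directed p) ¬d
  route-unique (facing _ _ r)  (facing _ _ r′) = cong facingMoves (firstReturn-unique r r′)
  route-unique (facing _ ¬a _) (backing _ a _) = contradiction a ¬a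
  route-unique (backing ¬d _ _) (ahead p)      = contradiction (ahead⇒directed p) ¬d
  route-unique (backing ¬d _ _) (behind p)     = contradiction (behind⇒directed p) ¬d
  route-unique (backing _ a _) (facing _ ¬a _) = contradiction a ¬a
  route-unique (backing _ _ r) (backing _ _ r′) = cong backingMoves (firstReturn-unique r r′)

  never-returns⇒above : ∀ {x} → s x ≡ up → ¬ (∃ λ n → height x (suc n) ≡ 0ℤ) → Above 0ℤ x
  -- The bound is 1 because the starting height 0 is not strictly above 0.
  never-returns⇒above {x} sx none = 1 , λ { {suc n} (s≤s _) → positive n }
    where
    positive : ∀ n → 0ℤ ℤ.< height x (suc n)
    positive n with k , eq ← height-keeps-sign n {x} (λ {m} _ p → none (m , p)) =
      subst (0ℤ ℤ.<_) (sym (trans eq (cong (_◃ suc k) sx))) (ℤ.+<+ z<s)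

  -- The starting point of reverse x lies at height 1 above that of x.
  never-returns⇒below : ∀ {x} → s x ≡ up → ¬ (∃ λ n → height (reverse x) (suc n) ≡ 0ℤ) → Below 0ℤ (ρ x)
  never-returns⇒below {x} sx none = 0 , λ {n} _ → nonpositive n
    where
    s≡down : s (reverse x) ≡ down
    s≡down = trans (s-reverse x) (cong opposite sx)
    bound : ∀ z {k} → δ down + z ≡ -[1+ k ] → z ℤ.≤ 0ℤ
    bound (pos zero) _ = ℤₚ.≤-refl
    bound -[1+ _ ]   _ = ℤ.-≤+
    nonpositive : ∀ n → height (ρ x) n ℤ.≤ 0ℤ
    nonpositive n with k , eq ← height-keeps-sign n {reverse x} (λ {m} _ p → none (m , p)) =
      bound (height (ρ x) n) (trans (cong₂ (λ c y → δ c + height y n) (sym s≡down) (sym (τρτ x)))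
        (trans eq (cong (_◃ suc k) s≡down)))

  -- Without a return ahead, the end ahead would stay above 0, which `facing` excludes. Without a
  -- return behind, the end behind stays at or below 0, so the end above 0 is the one ahead and the
  -- chain is directed.
  route : ∀ {x} → s x ≡ up → ∃ (Route x)
  route {x} sx with em {Directed x} | em {EndAbove 0ℤ x}
  ... | yes d | _ with directed⇒ahead⊎behind d
  ...   | inj₁ p = _ , ahead p
  ...   | inj₂ p = _ , behind p
  route {x} sx | no ¬d | no ¬a with em {∃ λ n → height x (suc n) ≡ 0ℤ}
  ... | yes (n , h≡0) = _ , facing ¬d ¬a (proj₂ (firstReturn n h≡0))
  ... | no none       = contradiction (inj₁ (never-returns⇒above sx none)) ¬a
  route {x} sx | no ¬d | yes a with em {∃ λ n → height (reverse x) (suc n) ≡ 0ℤ}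
  ... | yes (n , h≡0) = _ , backing ¬d a (proj₂ (firstReturn n h≡0))
  ... | no none       = contradiction (rising-one-way a) ¬d
    where
    below : Below 0ℤ (ρ x)
    below = never-returns⇒below sx none
    rising-one-way : EndAbove 0ℤ x → Directed x
    rising-one-way (inj₁ p) = inj₁ (0ℤ , p , below)
    rising-one-way (inj₂ p) = contradiction (above<below p below) (ℤₚ.<-irrefl refl)

  act-facing : ∀ n x → act (facingMoves n) x ≡ ρ (walk x (suc n))
  act-facing n x = act-replicate (suc n) (turn ∷ []) x

  act-backing : ∀ n x → act (backingMoves n) x ≡ reverse (ρ (walk (reverse x) (suc n)))
  act-backing n x = act-replicate (suc n) (turn ∷ advance ∷ turn ∷ []) (reverse x)

  route-κ : ∀ {x w} → Route x w → κ (act w x) ≡ not (κ x)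
  route-κ {x} (ahead _) with s (τ x)
  ... | up   = κ-τ x
  ... | down = trans (κ-reverse (τ x)) (κ-τ x)
  route-κ {x} (behind _) with s (ρ x)
  ... | up   = κ-ρ x
  ... | down = trans (κ-reverse (ρ x)) (κ-ρ x)
  route-κ {x} (facing {n} _ _ (h≡0 , _)) = trans (cong κ (act-facing n x)) (κ-return (suc n) x h≡0)
  route-κ {x} (backing {n} _ _ (h≡0 , _)) = trans (cong κ (act-backing n x))
    (trans (κ-reverse _) (trans (κ-return (suc n) (reverse x) h≡0) (cong not (κ-reverse x))))

  route-up : ∀ {x w} → Route x w → s x ≡ up → s (act w x) ≡ up
  route-up {x} (ahead _) _ with s (τ x) in eq
  ... | up   = eq
  ... | down = trans (s-reverse (τ x)) (cong opposite eq)
  route-up {x} (behind _) _ with s (ρ x) in eq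
  ... | up   = eq
  ... | down = trans (s-reverse (ρ x)) (cong opposite eq)
  route-up {x} (facing {n} _ _ r) sx = trans (cong s (act-facing n x)) (trans (s-return r) sx)
  route-up {x} (backing {n} _ _ r) sx = begin
    s (act (backingMoves n) x)                     ≡⟨ cong s (act-backing n x) ⟩
    s (reverse (ρ (walk (reverse x) (suc n))))     ≡⟨ s-reverse _ ⟩
    opposite (s (ρ (walk (reverse x) (suc n))))    ≡⟨ cong opposite (s-return r) ⟩
    opposite (s (reverse x))                       ≡⟨ cong opposite (s-reverse x) ⟩
    opposite (opposite (s x))                      ≡⟨ opposite-involutive (s x) ⟩
    s x                                            ≡⟨ sx ⟩
    up                                             ∎
    where open ≡-Reasoning

  Returning : S → S → Set a
  Returning x y = ∃ λ w → Route y w × act w y ≡ x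

  private
    returning-ahead : ∀ {x y c} → Ahead y → s (τ y) ≡ c → act (aheadMoves c) y ≡ x → Returning x y
    returning-ahead p refl eq = _ , ahead p , eq

    returning-behind : ∀ {x y c} → Behind y → s (ρ y) ≡ c → act (behindMoves c) y ≡ x → Returning x y
    returning-behind p refl eq = _ , behind p , eq

  -- On a directed chain the rule pairs neighbouring edges, and each points at the other. Otherwise
  -- the excursion read backwards is again a first return, over the same line.
  route-returns : ∀ {x w} → Route x w → s x ≡ up → Returning x (act w x)
  route-returns {x} (ahead p) sx with s (τ x)
  ... | up   = returning-behind (ahead-τ p) (trans (s-reverse x) (cong opposite sx)) (reverse-involutive x)
  ... | down = returning-ahead (ahead-ρ (behind-τ (ahead-τ p)))
    (trans (cong s (τρτ (τ x))) (trans (s-reverse x) (cong opposite sx)))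
    (trans (cong reverse (τρτ (τ x))) (reverse-involutive x))
  route-returns {x} (behind p) sx with s (ρ x)
  ... | up   = returning-behind (behind-ρ p) (trans (cong s (ρρ x)) sx) (ρρ x)
  ... | down = returning-ahead (ahead-ρ (behind-τ (behind-ρ p)))
    (trans (cong s back) sx) back
    where
    back : τ (ρ (τ (ρ x))) ≡ x
    back = trans (τρτ (ρ x)) (ρρ x)
  route-returns {x} (facing {n} ¬d ¬a r) _ = subst (Returning x) (sym (act-facing n x))
    ( facingMoves n
    , facing (¬d ∘ directed-return⁻ n) (¬a ∘ endAbove-return⁻ r) (firstReturn-back r)
    , trans (act-facing n _) (trans (cong ρ (walk-back (suc n) x)) (ρρ x)) )
  route-returns {x} (backing {n} ¬d a r) sx = subst (Returning x) (sym (act-backing n x))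
    ( backingMoves n
    , backing (¬d ∘ directed-reverse⁻ ∘ directed-return⁻ n ∘ directed-reverse⁻)
        -- Height 0 as seen from `x` is -1 as seen from `reverse x` and from `y`, which start one
        -- step higher, and 0 again as seen from `reverse y`.
        (endAbove-reverse⁺ (subst (λ c → EndAbove (δ c + 0ℤ) y) (sym sy)
          (endAbove-return⁺ r (endAbove-reverse⁺ (subst (λ c → EndAbove (δ c + δ down) x) (sym sx) a)))))
        (subst (λ z → FirstReturn z n) (sym (reverse-involutive y)) (firstReturn-back r))
    , (begin
        act (backingMoves n) (reverse y)                          ≡⟨ act-backing n (reverse y) ⟩
        reverse (ρ (walk (reverse (reverse y)) (suc n)))          ≡⟨ cong (λ z → reverse (ρ (walk z (suc n)))) (reverse-involutive y) ⟩
        reverse (ρ (walk y (suc n)))                              ≡⟨ cong (reverse ∘ ρ) (walk-back (suc n) (reverse x)) ⟩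
        reverse (ρ (ρ (reverse x)))                               ≡⟨ cong reverse (ρρ (reverse x)) ⟩
        reverse (reverse x)                                       ≡⟨ reverse-involutive x ⟩
        x                                                         ∎) )
    where
    open ≡-Reasoning
    y : S
    y = ρ (walk (reverse x) (suc n))
    sy : s y ≡ down
    sy = trans (s-return r) (trans (s-reverse x) (cong opposite sx))

  -- The pairing and its invariance.

  partner : ∀ x → s x ≡ up → S
  partner x sx = act (proj₁ (route sx)) x

  partner-act : ∀ {x w} → Route x w → (sx : s x ≡ up) → partner x sx ≡ act w x
  partner-act {x} r sx = cong (λ w → act w x) (route-unique (proj₂ (route sx)) r)

  partner-up : ∀ x (sx : s x ≡ up) → s (partner x sx) ≡ up
  partner-up x sx = route-up (proj₂ (route sx)) sx

  partner-κ : ∀ x (sx : s x ≡ up) → κ (partner x sx) ≡ not (κ x)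
  partner-κ x sx = route-κ (proj₂ (route sx))

  -- Stated for any `y` equal to the partner, since `stateᴴ (φ x)` will be so only propositionally.
  partner-involutive : ∀ {x y} (sx : s x ≡ up) (sy : s y ≡ up) → partner x sx ≡ y → partner y sy ≡ x
  partner-involutive sx sy refl with w , r , eq ← route-returns (proj₂ (route sx)) sx =
    trans (partner-act r sy) eq

  module Transport
    {r} (_~_ : Rel S r) (~-sym : ∀ {x y} → x ~ y → y ~ x)
    (~-τ : ∀ {x y} → x ~ y → τ x ~ τ y) (~-ρ : ∀ {x y} → x ~ y → ρ x ~ ρ y)
    (~-s : ∀ {x y} → x ~ y → s x ≡ s y) (~-κ : ∀ {x y} → x ~ y → κ x ≡ κ y)
    where

    ~-height : ∀ n {x y} → x ~ y → height x n ≡ height y n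
    ~-height zero    _ = refl
    ~-height (suc n) p = cong₂ (λ c z → δ c + z) (~-s p) (~-height n (~-τ p))

    ~-above : ∀ {ℓ x y} → x ~ y → Above ℓ x → Above ℓ y
    ~-above p (M , q) = M , λ {n} M≤n → subst (_ ℤ.<_) (~-height n p) (q M≤n)

    ~-below : ∀ {ℓ x y} → x ~ y → Below ℓ x → Below ℓ y
    ~-below p (M , q) = M , λ {n} M≤n → subst (ℤ._≤ _) (~-height n p) (q M≤n)

    ~-rising : ∀ {x y} → x ~ y → Rising x → Rising y
    ~-rising p (ℓ , a , b) = ℓ , ~-above p a , ~-below (~-ρ p) b

    ~-directed : ∀ {x y} → x ~ y → Directed x → Directed y
    ~-directed p = Sum.map (~-rising p) (~-rising (~-ρ p))

    ~-endAbove : ∀ {ℓ x y} → x ~ y → EndAbove ℓ x → EndAbove ℓ y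
    ~-endAbove p = Sum.map (~-above p) (~-above (~-ρ p))

    ~-ahead : ∀ {x y} → x ~ y → Ahead x → Ahead y
    ~-ahead p (inj₁ (k , q)) = inj₁ (trans (sym (~-κ p)) k , ~-rising p q)
    ~-ahead p (inj₂ (k , q)) = inj₂ (trans (sym (~-κ p)) k , ~-rising (~-ρ p) q)

    ~-behind : ∀ {x y} → x ~ y → Behind x → Behind y
    ~-behind p (inj₁ (k , q)) = inj₁ (trans (sym (~-κ p)) k , ~-rising (~-ρ p) q)
    ~-behind p (inj₂ (k , q)) = inj₂ (trans (sym (~-κ p)) k , ~-rising p q)

    ~-firstReturn : ∀ {x y n} → x ~ y → FirstReturn x n → FirstReturn y n
    ~-firstReturn {n = n} p (h≡0 , h≢0) =
      trans (sym (~-height (suc n) p)) h≡0 , λ {m} m<n → h≢0 m<n ∘ trans (~-height (suc m) p)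

    -- The cases and their words are determined by signs and kinds met along the chain in both
    -- directions, all of which related states share.
    ~-route : ∀ {x y w} → x ~ y → Route x w → Route y w
    ~-route {y = y} p (ahead q) =
      subst (Route y ∘ aheadMoves) (sym (~-s (~-τ p))) (ahead (~-ahead p q))
    ~-route {y = y} p (behind q) =
      subst (Route y ∘ behindMoves) (sym (~-s (~-ρ p))) (behind (~-behind p q))
    ~-route p (facing ¬d ¬a r) =
      facing (¬d ∘ ~-directed (~-sym p)) (¬a ∘ ~-endAbove (~-sym p)) (~-firstReturn p r)
    ~-route p (backing ¬d a r) =
      backing (¬d ∘ ~-directed (~-sym p)) (~-endAbove p a) (~-firstReturn (~-ρ (~-τ p)) r)

-- The swap of the two copies in a double cover.

flip : Fin 2 → Fin 2
flip zero       = suc zero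
flip (suc zero) = zero

flip-involutive : ∀ i → flip (flip i) ≡ i
flip-involutive zero       = refl
flip-involutive (suc zero) = refl

sign : Fin 2 → Sign
sign zero       = up
sign (suc zero) = down

sign-flip : ∀ i → sign (flip i) ≡ opposite (sign i)
sign-flip zero       = refl
sign-flip (suc zero) = refl

sign-up : ∀ i → sign i ≡ up → i ≡ zero
sign-up zero       _  = refl
sign-up (suc zero) ()

K₂-edge-sign : ∀ {i j} → K₂-Edge i j → sign i ≡ opposite (sign j)
K₂-edge-sign e₁₂ = refl
K₂-edge-sign e₂₁ = refl

K₂-edge-flip : ∀ {i j} → K₂-Edge i j → K₂-Edge (flip i) (flip j)
K₂-edge-flip e₁₂ = e₂₁
K₂-edge-flip e₂₁ = e₁₂

module _ {v e} (G : Graph v e) where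

  swap : V (K₂ ×ᴳ G) → V (K₂ ×ᴳ G)
  swap (i , x) = flip i , x

  swap-involutive : ∀ p → swap (swap p) ≡ p
  swap-involutive (i , x) = cong (_, x) (flip-involutive i)

  swap-edge : ∀ {p q} → E (K₂ ×ᴳ G) p q → E (K₂ ×ᴳ G) (swap p) (swap q)
  swap-edge (ij , xy) = K₂-edge-flip ij , xy

-- From isomorphic double covers to isomorphic complexes.

module DoubleCovers {v e v′ e′} (G : Graph v e) (H : Graph v′ e′)
  (i : K₂ ×ᴳ G ≅ᴳ K₂ ×ᴳ H) (em : ExcludedMiddle 0ℓ) where

  private
    module I where
      open _≅ᴳ_ i public
      open Inverse vertices public

  P : Set v
  P = V (K₂ ×ᴳ G)

  swapᴴ : P → P
  swapᴴ p = I.from (swap H (I.to p))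

  to-swapᴴ : ∀ p → I.to (swapᴴ p) ≡ swap H (I.to p)
  to-swapᴴ p = I.strictlyInverseˡ (swap H (I.to p))

  swapᴴ-involutive : ∀ p → swapᴴ (swapᴴ p) ≡ p
  swapᴴ-involutive p = trans (cong (I.from ∘ swap H) (to-swapᴴ p))
    (trans (cong I.from (swap-involutive H (I.to p))) (I.strictlyInverseʳ p))

  swapᴴ-edge : ∀ {p q} → E (K₂ ×ᴳ G) p q → E (K₂ ×ᴳ G) (swapᴴ p) (swapᴴ q)
  swapᴴ-edge {p} {q} pq = Equivalence.from (I.edges (swapᴴ p) (swapᴴ q))
    (subst₂ (E (K₂ ×ᴳ H)) (sym (to-swapᴴ p)) (sym (to-swapᴴ q))
      (swap-edge H (Equivalence.to (I.edges p q) pq)))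

  -- `(p , b)` is the chain edge travelled from `p` to its image under `swap G` if `b` is `true`,
  -- under `swapᴴ` if `false`.
  State : Set v
  State = P × Bool

  τ ρ : State → State
  τ (p , true)  = swap G p , false
  τ (p , false) = swapᴴ p , true
  ρ (p , b)     = p , not b

  s : State → Sign
  s (p , true)  = sign (proj₁ p)
  s (p , false) = sign (proj₁ (I.to p))

  ρρ : ∀ x → ρ (ρ x) ≡ x
  ρρ (p , b) = cong (p ,_) (not-involutive b)

  τρτ : ∀ x → τ (ρ (τ x)) ≡ ρ x
  τρτ (p , true)  = cong (_, false) (swap-involutive G p)
  τρτ (p , false) = cong (_, true) (swapᴴ-involutive p)

  s-reverse : ∀ x → s (ρ (τ x)) ≡ opposite (s x)
  s-reverse (p , true)  = sign-flip (proj₁ p)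
  s-reverse (p , false) = trans (cong (sign ∘ proj₁) (to-swapᴴ p)) (sign-flip (proj₁ (I.to p)))

  κ-τ : ∀ x → proj₂ (τ x) ≡ not (proj₂ x)
  κ-τ (p , true)  = refl
  κ-τ (p , false) = refl

  open Chain τ ρ s proj₂ ρρ τρτ s-reverse κ-τ (λ _ → refl) em

  Adjacent : State → State → Set e
  Adjacent (p , b) (q , c) = E (K₂ ×ᴳ G) p q × b ≡ c

  adjacent-τ : ∀ {x u} → Adjacent x u → Adjacent (τ x) (τ u)
  adjacent-τ {_ , true}  (pq , refl) = swap-edge G pq , refl
  adjacent-τ {_ , false} (pq , refl) = swapᴴ-edge pq , refl

  adjacent-ρ : ∀ {x u} → Adjacent x u → Adjacent (ρ x) (ρ u)
  adjacent-ρ (pq , eq) = pq , cong not eq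

  adjacent-act : ∀ w {x u} → Adjacent x u → Adjacent (act w x) (act w u)
  adjacent-act []            a = a
  adjacent-act (advance ∷ w) a = adjacent-act w (adjacent-τ a)
  adjacent-act (turn ∷ w)    a = adjacent-act w (adjacent-ρ a)

  -- An edge of `K₂ ×ᴳ G` joins the two copies of `G` and, through the isomorphism, also the two
  -- copies of `H`.
  adjacent-s : ∀ {x u} → Adjacent x u → s x ≡ opposite (s u)
  adjacent-s {_ , true}      (pq , refl) = K₂-edge-sign (proj₁ pq)
  adjacent-s {p , false} {q , _} (pq , refl) = K₂-edge-sign (proj₁ (Equivalence.to (I.edges p q) pq))

  _~_ : Rel State _
  x ~ y = ∃ λ u → Adjacent x u × Adjacent y u

  open Transport _~_ (λ (u , a , b) → u , b , a)
    (λ (u , a , b) → τ u , adjacent-τ a , adjacent-τ b)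
    (λ (u , a , b) → ρ u , adjacent-ρ a , adjacent-ρ b)
    (λ (u , a , b) → trans (adjacent-s a) (sym (adjacent-s b)))
    (λ (u , a , b) → trans (proj₂ a) (sym (proj₂ b)))

  module _ {x} {X : Set x} (f : X → State) (f-up : ∀ a → s (f a) ≡ up) where

    -- By `~-route` the word of the first member is a route for all. Applied to `u`, for which it
    -- need not be a route, it still gives a common neighbour of the partners, as both moves
    -- preserve adjacency.
    partner-simplex : ∀ u xs → All (λ a → Adjacent (f a) u) xs →
      ∃ λ u′ → All (λ a → Adjacent (partner (f a) (f-up a)) u′) xs
    partner-simplex u []           []       = u , []
    partner-simplex u xs@(a₀ ∷ _) (a₀u ∷ au) with w , r ← route (f-up a₀) =
      act w u , All.map (λ {a} au → subst (λ y → Adjacent y (act w u))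
        (sym (partner-act (~-route (u , a₀u , au) r) (f-up a))) (adjacent-act w au)) (a₀u ∷ au)

  stateᴳ : V G → State
  stateᴳ x = (zero , x) , true

  stateᴴ : V H → State
  stateᴴ y = I.from (zero , y) , false

  stateᴴ-up : ∀ y → s (stateᴴ y) ≡ up
  stateᴴ-up y = cong (sign ∘ proj₁) (I.strictlyInverseˡ (zero , y))

  vertexᴳ : State → V G
  vertexᴳ (p , _) = proj₂ p

  vertexᴴ : State → V H
  vertexᴴ (p , _) = proj₂ (I.to p)

  stateᴳ-vertexᴳ : ∀ {x} → proj₂ x ≡ true → s x ≡ up → stateᴳ (vertexᴳ x) ≡ x
  stateᴳ-vertexᴳ {(i , y) , true} refl sx = cong (λ j → (j , y) , true) (sym (sign-up i sx))

  stateᴴ-vertexᴴ : ∀ {x} → proj₂ x ≡ false → s x ≡ up → stateᴴ (vertexᴴ x) ≡ x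
  stateᴴ-vertexᴴ {p , false} refl sx = cong (_, false)
    (trans (cong (λ j → I.from (j , proj₂ (I.to p))) (sym (sign-up _ sx))) (I.strictlyInverseʳ p))

  φ : V G → V H
  φ x = vertexᴴ (partner (stateᴳ x) refl)

  φ⁻¹ : V H → V G
  φ⁻¹ y = vertexᴳ (partner (stateᴴ y) (stateᴴ-up y))

  stateᴴ-φ : ∀ x → stateᴴ (φ x) ≡ partner (stateᴳ x) refl
  stateᴴ-φ x = stateᴴ-vertexᴴ (partner-κ (stateᴳ x) refl) (partner-up (stateᴳ x) refl)

  stateᴳ-φ⁻¹ : ∀ y → stateᴳ (φ⁻¹ y) ≡ partner (stateᴴ y) (stateᴴ-up y)
  stateᴳ-φ⁻¹ y = stateᴳ-vertexᴳ (partner-κ (stateᴴ y) (stateᴴ-up y)) (partner-up (stateᴴ y) (stateᴴ-up y))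

  partner-φ : ∀ x → partner (stateᴴ (φ x)) (stateᴴ-up (φ x)) ≡ stateᴳ x
  partner-φ x = partner-involutive refl _ (sym (stateᴴ-φ x))

  φ⁻¹φ : ∀ x → φ⁻¹ (φ x) ≡ x
  φ⁻¹φ x = cong vertexᴳ (partner-φ x)

  φφ⁻¹ : ∀ y → φ (φ⁻¹ y) ≡ y
  φφ⁻¹ y = trans (cong vertexᴴ (partner-involutive (stateᴴ-up y) refl (sym (stateᴳ-φ⁻¹ y))))
    (cong proj₂ (I.strictlyInverseˡ (zero , y)))

  -- The map `f` admits lists of vertices that carry a proof of being non-isolated.
  φ-simplex : ∀ {x} {X : Set x} (f : X → V G) u xs → All (λ a → E G u (f a)) xs →
    ∃ λ u′ → All (λ a → E H u′ (φ (f a))) xs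
  φ-simplex f u xs σ
    -- The centre `u` is taken in copy 1, since `stateᴳ` places the members in copy 0.
    with u′ , σ′ ← partner-simplex (stateᴳ ∘ f) (λ _ → refl) ((suc zero , u) , true) xs
                     (All.map (λ ua → (e₁₂ , Graph.symE G ua) , refl) σ) =
    vertexᴴ u′ , All.map (λ { (pq , _) → Graph.symE H (proj₂ (Equivalence.to (I.edges _ _) pq)) }) σ′

  -- The same argument started in `H`; `partner-φ` identifies the partners with the original
  -- vertices.
  φ⁻¹-simplex : ∀ {x} {X : Set x} (f : X → V G) u xs → All (λ a → E H u (φ (f a))) xs →
    ∃ λ u′ → All (λ a → E G u′ (f a)) xs
  φ⁻¹-simplex f u xs σ
    with u′ , σ′ ← partner-simplex (stateᴴ ∘ φ ∘ f) (λ a → stateᴴ-up (φ (f a)))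
                     (I.from (suc zero , u) , false) xs
                     (All.map (λ ua → Equivalence.from (I.edges _ _)
                       (subst₂ (E (K₂ ×ᴳ H)) (sym (I.strictlyInverseˡ _)) (sym (I.strictlyInverseˡ _))
                         (e₁₂ , Graph.symE H ua)) , refl) σ) =
    vertexᴳ u′ , All.map (λ {a} → edge (partner-φ (f a))) σ′
    where
    edge : ∀ {x y z} → x ≡ stateᴳ y → Adjacent x z → E G (vertexᴳ z) y
    edge refl (pq , _) = Graph.symE G (proj₂ pq)

  neighborhoodComplex-≅ : (∀ x → Satisfiable (Graph.N G x)) → (∀ y → Satisfiable (Graph.N H y)) →
    neighborhoodComplex G ≅ˢ neighborhoodComplex H
  neighborhoodComplex-≅ neighbourᴳ neighbourᴴ = record
    { vertices = record
      { to        = λ (x , _) → φ x , neighbourᴴ (φ x)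
      ; from      = λ (y , _) → φ⁻¹ y , neighbourᴳ (φ⁻¹ y)
      ; to-cong   = cong φ
      ; from-cong = cong φ⁻¹
      ; inverse   = (λ { {y , _} refl → φφ⁻¹ y }) , (λ { {x , _} refl → φ⁻¹φ x })
      }
    ; simplices = λ xs → mk⇔
        (λ (u , σ) → let u′ , σ′ = φ-simplex proj₁ u xs σ in u′ , Allₚ.map⁺ σ′)
        (λ (u , σ) → φ⁻¹-simplex proj₁ u xs (Allₚ.map⁻ σ))
    }

-- Neighbours of non-isolated vertices and inverses of complex isomorphisms.

lower-em : ∀ {a} b → ExcludedMiddle (a ⊔ b) → ExcludedMiddle a
lower-em b em {A} = map′ lower lift (em {Lift b A})

-- `WithoutIsolated` only refutes the absence of neighbours, while a vertex of the complex must
-- exhibit one.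
em-neighbour : ∀ {v e} (G : Graph v e) → ExcludedMiddle (v ⊔ e) → WithoutIsolated G →
               ∀ x → Satisfiable (Graph.N G x)
em-neighbour G em none x = decidable-stable em λ ¬xy → none x λ y xy → ¬xy (y , xy)

≅ˢ-sym : ∀ {c ℓ s c′ ℓ′ s′} {K : SimplicialComplex c ℓ s} {L : SimplicialComplex c′ ℓ′ s′} →
         K ≅ˢ L → L ≅ˢ K
≅ˢ-sym {K = K} {L} i = record
  { vertices  = Symmetry.inverse I.vertices
  ; simplices = λ ys → mk⇔
      (λ σ → Equivalence.from (I.simplices (map I.from ys)) (L.downward (round⊆ ys) σ))
      (λ σ → L.downward (⊆round ys) (Equivalence.to (I.simplices (map I.from ys)) σ))
  }
  where
  module K = SimplicialComplex K
  module L = SimplicialComplex L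
  module I where
    open _≅ˢ_ i public
    open Inverse vertices public
  module S = Setoid L.vertices
  round⊆ : ∀ ys {y} → Any.Any (y S.≈_) (map I.to (map I.from ys)) → Any.Any (y S.≈_) ys
  round⊆ ys m = Any.map (λ p → S.trans p (I.strictlyInverseˡ _)) (Anyₚ.map⁻ (Anyₚ.map⁻ m))
  ⊆round : ∀ ys {y} → Any.Any (y S.≈_) ys → Any.Any (y S.≈_) (map I.to (map I.from ys))
  ⊆round ys m = Anyₚ.map⁺ (Anyₚ.map⁺ (Any.map (λ p → S.trans p (S.sym (I.strictlyInverseˡ _))) m))

module _ {v e} (G : Graph v e) where
  open Graph G using (N)

  -- The enumerating list of `N x` is either empty or supplies a neighbour, so this direction stays
  -- constructive.
  finite-neighbour : LocallyFinite G → WithoutIsolated G → ∀ x → Satisfiable (N x)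
  finite-neighbour finite none x with finite x
  ... | []    , eq = contradiction (λ y xy → Anyₚ.¬Any[] (Equivalence.to (eq y) xy)) (none x)
  ... | y ∷ _ , eq = y , Equivalence.from (eq y) (here refl)

-- From isomorphic complexes to isomorphic double covers.

module _ {v e v′ e′} (G : Graph v e) (H : Graph v′ e′)
         (neighbour : ∀ x → Satisfiable (Graph.N G x)) (finite : LocallyFinite G)
         (i : neighborhoodComplex G ≅ˢ neighborhoodComplex H) where
  private
    module G = Graph G
    module H = Graph H
    module I where
      open _≅ˢ_ i public
      open Inverse vertices public

  -- Being finite, `N u` is itself a simplex, so its image lies in a single neighbourhood.
  image-of-neighbourhood : ∀ u → ∃ λ w → ∀ x → proj₁ x ∈ G.N u → proj₁ (I.to x) ∈ H.N w
  image-of-neighbourhood u = proj₁ image , λ x x∈Nu →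
      -- The list pairs the vertex with its chosen neighbour, `x` with an arbitrary one; `I.to-cong`
      -- bridges the two.
      subst (_∈ H.N (proj₁ image)) (I.to-cong refl)
        (All.lookup (Allₚ.map⁻ (Allₚ.map⁻ (proj₂ image))) (Equivalence.to (proj₂ (finite u) (proj₁ x)) x∈Nu))
    where
    image : ∃ λ w → All ((_∈ H.N w) ∘ proj₁) (map I.to (map (λ x → x , neighbour x) (proj₁ (finite u))))
    image = Equivalence.to (I.simplices _)
      (u , Allₚ.map⁺ (All.tabulate λ {x} x∈ → Equivalence.from (proj₂ (finite u) x) x∈))

module _ {v e v′ e′} (G : Graph v e) (H : Graph v′ e′)
         (neighbourᴳ : ∀ x → Satisfiable (Graph.N G x)) (neighbourᴴ : ∀ x → Satisfiable (Graph.N H x))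
         (finiteᴳ : LocallyFinite G) (finiteᴴ : LocallyFinite H)
         (stiffᴳ : Stiff G) (stiffᴴ : Stiff H)
         (i : neighborhoodComplex G ≅ˢ neighborhoodComplex H) where
  private
    module G = Graph G
    module H = Graph H
    module I where
      open _≅ˢ_ i public
      open Inverse vertices public

    φ : V G → V H
    φ x = proj₁ (I.to (x , neighbourᴳ x))
    φ⁻¹ : V H → V G
    φ⁻¹ y = proj₁ (I.from (y , neighbourᴴ y))

    φφ⁻¹ : ∀ y → φ (φ⁻¹ y) ≡ y
    φφ⁻¹ y = trans (I.to-cong refl) (I.strictlyInverseˡ (y , neighbourᴴ y))
    φ⁻¹φ : ∀ x → φ⁻¹ (φ x) ≡ x
    φ⁻¹φ x = trans (I.from-cong refl) (I.strictlyInverseʳ (x , neighbourᴳ x))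

    θ : V G → V H
    θ u = proj₁ (image-of-neighbourhood G H neighbourᴳ finiteᴳ i u)
    θ⁻¹ : V H → V G
    θ⁻¹ w = proj₁ (image-of-neighbourhood H G neighbourᴴ finiteᴴ (≅ˢ-sym i) w)

    θ-edge : ∀ {u x} → E G u x → E H (θ u) (φ x)
    θ-edge {u} {x} = proj₂ (image-of-neighbourhood G H neighbourᴳ finiteᴳ i u) (x , neighbourᴳ x)
    θ⁻¹-edge : ∀ {w y} → E H w y → E G (θ⁻¹ w) (φ⁻¹ y)
    θ⁻¹-edge {w} {y} =
      proj₂ (image-of-neighbourhood H G neighbourᴴ finiteᴴ (≅ˢ-sym i) w) (y , neighbourᴴ y)

    -- The two edge maps give an inclusion of `N u` in `N (θ⁻¹ (θ u))`, which stiffness turns into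
    -- equality of the centres.
    θ⁻¹θ : ∀ u → θ⁻¹ (θ u) ≡ u
    θ⁻¹θ u = sym (stiffᴳ u (θ⁻¹ (θ u)) λ {x} ux →
      subst (E G (θ⁻¹ (θ u))) (φ⁻¹φ x) (θ⁻¹-edge (θ-edge ux)))
    θθ⁻¹ : ∀ w → θ (θ⁻¹ w) ≡ w
    θθ⁻¹ w = sym (stiffᴴ w (θ (θ⁻¹ w)) λ {y} wy →
      subst (E H (θ (θ⁻¹ w))) (φφ⁻¹ y) (θ-edge (θ⁻¹-edge wy)))

    θ-reflects : ∀ {u x} → E H (θ u) (φ x) → E G u x
    θ-reflects {u} {x} p = subst₂ (E G) (θ⁻¹θ u) (φ⁻¹φ x) (θ⁻¹-edge p)

    -- Copy 0 holds members of neighbourhoods, moved by `φ`; copy 1 holds centres, moved by `θ`.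
    -- Every edge joins a member to a centre.
    to : Fin 2 × V G → Fin 2 × V H
    to (zero , x)     = zero , φ x
    to (suc zero , x) = suc zero , θ x
    from : Fin 2 × V H → Fin 2 × V G
    from (zero , y)     = zero , φ⁻¹ y
    from (suc zero , y) = suc zero , θ⁻¹ y
    to-from : ∀ q → to (from q) ≡ q
    to-from (zero , y)     = cong (zero ,_) (φφ⁻¹ y)
    to-from (suc zero , y) = cong (suc zero ,_) (θθ⁻¹ y)
    from-to : ∀ p → from (to p) ≡ p
    from-to (zero , x)     = cong (zero ,_) (φ⁻¹φ x)
    from-to (suc zero , x) = cong (suc zero ,_) (θ⁻¹θ x)

    edges : ∀ p q → E (K₂ ×ᴳ G) p q ⇔ E (K₂ ×ᴳ H) (to p) (to q)
    edges (zero , x) (zero , y)         = mk⇔ (λ { (() , _) }) (λ { (() , _) })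
    edges (zero , x) (suc zero , y)     = mk⇔
      (λ { (e₁₂ , xy) → e₁₂ , H.symE (θ-edge (G.symE xy)) })
      (λ { (e₁₂ , xy) → e₁₂ , G.symE (θ-reflects (H.symE xy)) })
    edges (suc zero , x) (zero , y)     = mk⇔
      (λ { (e₂₁ , xy) → e₂₁ , θ-edge xy })
      (λ { (e₂₁ , xy) → e₂₁ , θ-reflects xy })
    edges (suc zero , x) (suc zero , y) = mk⇔ (λ { (() , _) }) (λ { (() , _) })

  double-cover-≅ : K₂ ×ᴳ G ≅ᴳ K₂ ×ᴳ H
  double-cover-≅ = record { vertices = mk↔ₛ′ to from to-from from-to ; edges = edges }

theorem1p1 : ∀ {v e v′ e′} (G : Graph v e) (H : Graph v′ e′) →
    WithoutIsolated G → WithoutIsolated H →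
    (ExcludedMiddle (v ⊔ e ⊔ v′ ⊔ e′) →
    K₂ ×ᴳ G ≅ᴳ K₂ ×ᴳ H → neighborhoodComplex G ≅ˢ neighborhoodComplex H)
    ×
    (LocallyFinite G → LocallyFinite H → Stiff G → Stiff H →
    neighborhoodComplex G ≅ˢ neighborhoodComplex H → K₂ ×ᴳ G ≅ᴳ K₂ ×ᴳ H)
theorem1p1 {v} {e} {v′} {e′} G H noneᴳ noneᴴ =
  (λ em i → DoubleCovers.neighborhoodComplex-≅ G H i (lower-em (v ⊔ e ⊔ v′ ⊔ e′) em)
    (em-neighbour G (lower-em (v′ ⊔ e′) em) noneᴳ)
    (em-neighbour H (lower-em (v ⊔ e) em) noneᴴ)) ,
  (λ finiteᴳ finiteᴴ stiffᴳ stiffᴴ → double-cover-≅ G H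
    (finite-neighbour G finiteᴳ noneᴳ) (finite-neighbour H finiteᴴ noneᴴ) finiteᴳ finiteᴴ stiffᴳ stiffᴴ)
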